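{- Let $R_1,R_2$ be infinite recursive rings. Then there exists a surjective recursively enumerable preserving function $f:R_1\to R_2$ that is not a recursive function.
   Context: A recursive ring is a ring $R$ with a fixed recursive representation, i.e. an injection $j:R\to\mathbb N$ with recursive image for which addition and multiplication are translated to (restrictions of) recursive functions. A subset of $R$ is recursively enumerable if its image under $j$ is. A function $f:R_1\to R_2$ is recursive if its translation $j_2\circ f\circ j_1^{ -1}$ is the restriction of a recursive function. A function $f:R_1\to R_2$ is recursively enumerable preserving (r.e. preserving) if for all recursively enumerable $S\subset R_1$ the set $f(S)\subset R_2$ is recursively enumerable. -}

module Defs where

open import Level using (Level; _⊔_) renaming (suc to lsuc)
open import Algebra.Bundles using (Ring)
open import Data.Fin using (Fin)
open import Data.List.Relation.Unary.Enumerates.Setoid using (IsEnumeration)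
open import Data.Nat using (ℕ; zero; suc; _<_)
open import Data.Product using (∃; ∃-syntax; _×_; _,_)
open import Data.Sum using (_⊎_)
open import Data.Vec using (Vec; []; _∷_; lookup)
open import Data.Vec.Relation.Binary.Pointwise.Inductive using (Pointwise)
open import Function.Bundles using (Injection; _⇔_)
open import Relation.Binary.PropositionalEquality using (_≡_; setoid)
open import Relation.Nullary using (¬_)
open import Relation.Unary using (Pred; _∈_; _∉_; Empty)

private
  variable
    a c ℓ c₁ ℓ₁ c₂ ℓ₂ : Level
    m n : ℕ

data Code : ℕ → Set where
  Zero : Code 0
  Succ : Code 1
  Proj : Fin n → Code n
  Comp : Code m → Vec (Code n) m → Code n
  Rec  : Code n → Code (suc (suc n)) → Code (suc n)
  Min  : Code (suc n) → Code n

infix 4 _[_]⇓_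

-- e [ xs ]⇓ y : the partial function with code e is defined at xs, with
-- value y.  The recursion variable and the minimisation variable come first;
-- the step function of Rec receives (index, previous value, parameters).
data _[_]⇓_ : Code n → Vec ℕ n → ℕ → Set where
  ⇓Zero : Zero [ [] ]⇓ 0
  ⇓Succ : ∀ {x} → Succ [ x ∷ [] ]⇓ suc x
  ⇓Proj : ∀ {xs : Vec ℕ n} {i} → Proj i [ xs ]⇓ lookup xs i
  ⇓Comp : ∀ {f : Code m} {gs : Vec (Code n) m} {xs ys y} →
          Pointwise (λ g z → g [ xs ]⇓ z) gs ys →
          f [ ys ]⇓ y →
          Comp f gs [ xs ]⇓ y
  ⇓Rec₀ : ∀ {f : Code n} {g xs y} →
          f [ xs ]⇓ y →
          Rec f g [ zero ∷ xs ]⇓ y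
  ⇓Recₛ : ∀ {f : Code n} {g k xs z y} →
          Rec f g [ k ∷ xs ]⇓ z →
          g [ k ∷ z ∷ xs ]⇓ y →
          Rec f g [ suc k ∷ xs ]⇓ y
  ⇓Min  : ∀ {f : Code (suc n)} {xs k} →
          f [ k ∷ xs ]⇓ 0 →
          (∀ i → i < k → ∃[ z ] f [ i ∷ xs ]⇓ suc z) →
          Min f [ xs ]⇓ k

-- Recursive functions are total.  Below, functions on the image of a ring are
-- required to be restrictions of such; allowing partial recursive extensions
-- would make no difference, since that image is a recursive set.
Recursive : (Vec ℕ n → ℕ) → Set
Recursive f = ∃[ e ] (∀ xs → e [ xs ]⇓ f xs)

RecursiveSet : Pred ℕ a → Set a
RecursiveSet A = ∃[ χ ] Recursive {1} χ ×
  (∀ k → (k ∈ A × χ (k ∷ []) ≡ 1) ⊎ (k ∉ A × χ (k ∷ []) ≡ 0))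

RESet : Pred ℕ a → Set a
RESet A = Empty A ⊎
  (∃[ h ] Recursive {1} h × (∀ k → k ∈ A ⇔ (∃[ i ] h (i ∷ []) ≡ k)))

record RecursiveRing c ℓ : Set (lsuc (c ⊔ ℓ)) where
  field
    ring : Ring c ℓ

  open Ring ring public
    using (Carrier; _≈_; _+_; _*_)
    renaming (setoid to ringSetoid)

  field
    representation : Injection ringSetoid (setoid ℕ)

  open Injection representation public using () renaming (to to j)

  field
    image-recursive : RecursiveSet (λ k → ∃[ x ] j x ≡ k)
    +-recursive     : ∃[ g ] Recursive {2} g ×
                      (∀ x y → g (j x ∷ j y ∷ []) ≡ j (x + y))
    *-recursive     : ∃[ g ] Recursive {2} g ×
                      (∀ x y → g (j x ∷ j y ∷ []) ≡ j (x * y))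

open RecursiveRing using (Carrier; ringSetoid)

Infinite : RecursiveRing c ℓ → Set (c ⊔ ℓ)
Infinite R = ¬ (∃[ xs ] IsEnumeration (ringSetoid R) xs)

-- S need not respect the ring's _≈_: j does, so S and its ≈-closure have the
-- same image in ℕ.
RESubset : (R : RecursiveRing c ℓ) → Pred (Carrier R) a → Set (c ⊔ a)
RESubset R S = RESet (λ k → ∃[ x ] x ∈ S × j x ≡ k)
  where open RecursiveRing R using (j)

module _ (R₁ : RecursiveRing c₁ ℓ₁) (R₂ : RecursiveRing c₂ ℓ₂) where
  private
    module R₁ = RecursiveRing R₁
    module R₂ = RecursiveRing R₂

  RecursiveMap : (R₁.Carrier → R₂.Carrier) → Set c₁
  RecursiveMap f = ∃[ g ] Recursive {1} g ×
    (∀ x → g (R₁.j x ∷ []) ≡ R₂.j (f x))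

  image : (R₁.Carrier → R₂.Carrier) → Pred R₁.Carrier a →
          Pred R₂.Carrier (c₁ ⊔ ℓ₂ ⊔ a)
  image f S y = ∃[ x ] x ∈ S × f x R₂.≈ y

  -- The universe level of S is immaterial: an r.e. subset of R₁ is empty or
  -- { x | j x ∈ range h } for some recursive h.
  REPreserving : (R₁.Carrier → R₂.Carrier) → Set (lsuc (c₁ ⊔ ℓ₁) ⊔ c₂ ⊔ ℓ₂)
  REPreserving f = (S : Pred R₁.Carrier (c₁ ⊔ ℓ₁)) →
    RESubset R₁ S → RESubset R₂ (image f S)

{-# OPTIONS --safe #-}
module Submission where

-- Call a subset of ℕ unbounded if it has arbitrarily large elements.  There
-- are countably many requirements of the following two kinds, where e ranges
-- over codes of unary functions and n over ℕ:
--
--   takes e n : if the range of e is unbounded, then F takes at some point of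
--               that range the element of R₂ represented by n, if any;
--   differs e : at some point of the image of R₁, e does not evaluate to the
--               number that represents the value of F there.
--
-- Each requirement only asks for a prescribed value of F at one point of some
-- unbounded set.  Classically one can go through the requirements one by one
-- and pick, each time, a point larger than all earlier ones, so one function F
-- meets them all (satisfy-all).  Let f = F ∘ j₁.
--
-- An r.e. subset of R₁ with unbounded image is then sent by f onto all of R₂,
-- which is r.e.; any other r.e. subset of R₁ is finite, and is sent to a finite
-- set, which is r.e. as well.  Hence f is r.e. preserving.  As R₁ is itself an r.e.
-- set with unbounded image, f is surjective.  The requirements of the second
-- kind keep f from being recursive.

open import Level using (Level; 0ℓ)
open import Algebra.Bundles using (Ring)
open import Axiom.ExcludedMiddle using (ExcludedMiddle)
open import Data.Empty using (⊥-elim)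
open import Data.Fin using (zero; suc; toℕ)
open import Data.Fin.Properties using (toℕ-injective)
open import Data.List using (List; []; _∷_; map; filter; upTo)
import Data.List.Membership.Propositional as Membership
open import Data.List.Membership.Propositional.Properties
  using (∈-map⁺; ∈-map⁻; ∈-filter⁺; ∈-filter⁻; ∈-upTo⁺)
open import Data.List.Relation.Unary.Any as Any using (here; there)
open import Data.List.Relation.Unary.Any.Properties using (map⁺)
open import Data.Nat using (ℕ; zero; suc; _*_; _≤_; _<_; _≤′_; ≤′-refl; ≤′-step)
open import Data.Nat.Properties
  using (suc-injective; *-cancelˡ-≡; even≢odd; 0≢1+n; ≰⇒>; <-cmp; ≤-refl;
         <⇒≢; m<n⇒m<1+n; ≤⇒≤′; <-≤-trans)
open import Data.Product using (Σ-syntax; ∃; ∃-syntax; _×_; _,_; proj₁; proj₂)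
open import Data.Sum using (_⊎_; inj₁; inj₂)
open import Data.Vec using (Vec; []; _∷_)
open import Data.Vec.Relation.Binary.Pointwise.Inductive using (Pointwise; []; _∷_)
open import Function.Base using (_∘_)
open import Function.Bundles using (Surjection; Injection; _⇔_; mk⇔; module Equivalence)
open import Relation.Binary.Definitions using (tri<; tri≈; tri>)
open import Relation.Binary.PropositionalEquality
  using (_≡_; refl; sym; trans; cong; cong₂; subst)
open import Relation.Nullary using (¬_; Dec; yes; no)
open import Relation.Unary using (Pred)
open import Defs

open Equivalence using (to; from)

private
  variable
    a b : Level
    m n : ℕ

-- Codes are countable

-- The pairing ⟨a, b⟩ ↦ 2ᵃ (2 b + 1).
pair : ℕ → ℕ → ℕ
pair zero    b = suc (2 * b)
pair (suc a) b = 2 * pair a b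

pair-injective : ∀ a b a′ b′ → pair a b ≡ pair a′ b′ → a ≡ a′ × b ≡ b′
pair-injective zero    b zero     b′ eq =
  refl , *-cancelˡ-≡ b b′ 2 (suc-injective eq)
pair-injective zero    b (suc a′) b′ eq = ⊥-elim (even≢odd (pair a′ b′) b (sym eq))
pair-injective (suc a) b zero     b′ eq = ⊥-elim (even≢odd (pair a b) b′ eq)
pair-injective (suc a) b (suc a′) b′ eq
  with refl , b≡b′ ← pair-injective a b a′ b′
                       (*-cancelˡ-≡ (pair a b) (pair a′ b′) 2 eq) = refl , b≡b′

-- A Gödel numbering: a code is numbered by its outermost constructor (its
-- tag) together with the numbers of its arguments (its payload).
tag : Code n → ℕ
tag Zero       = 0
tag Succ       = 1
tag (Proj _)   = 2
tag (Comp _ _) = 3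
tag (Rec _ _)  = 4
tag (Min _)    = 5

mutual
  ⌜_⌝ : Code n → ℕ
  ⌜ c ⌝ = pair (tag c) (payload c)

  payload : Code n → ℕ
  payload Zero            = 0
  payload Succ            = 0
  payload (Proj i)        = toℕ i
  payload (Comp {m} f gs) = pair m (pair ⌜ f ⌝ (payloads gs))
  payload (Rec f g)       = pair ⌜ f ⌝ ⌜ g ⌝
  payload (Min f)         = ⌜ f ⌝

  payloads : Vec (Code n) m → ℕ
  payloads []       = 0
  payloads (g ∷ gs) = pair ⌜ g ⌝ (payloads gs)

mutual
  ⌜⌝-injective : (c d : Code n) → ⌜ c ⌝ ≡ ⌜ d ⌝ → c ≡ d
  ⌜⌝-injective c d eq =
    let tags , loads = pair-injective (tag c) (payload c) (tag d) (payload d) eq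
    in payload-injective c d tags loads

  payload-injective : (c d : Code n) → tag c ≡ tag d → payload c ≡ payload d → c ≡ d
  payload-injective Zero     Zero     refl _  = refl
  payload-injective Succ     Succ     refl _  = refl
  payload-injective (Proj i) (Proj k) refl eq = cong Proj (toℕ-injective eq)
  payload-injective (Comp {m} f gs) (Comp {m′} f′ gs′) refl eq
    with refl , eq′ ← pair-injective m (pair ⌜ f ⌝ (payloads gs))
                                     m′ (pair ⌜ f′ ⌝ (payloads gs′)) eq
    with eqf , eqs ← pair-injective ⌜ f ⌝ (payloads gs) ⌜ f′ ⌝ (payloads gs′) eq′
    = cong₂ Comp (⌜⌝-injective f f′ eqf) (payloads-injective gs gs′ eqs)
  payload-injective (Rec f g) (Rec f′ g′) refl eq
    with eqf , eqg ← pair-injective ⌜ f ⌝ ⌜ g ⌝ ⌜ f′ ⌝ ⌜ g′ ⌝ eq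
    = cong₂ Rec (⌜⌝-injective f f′ eqf) (⌜⌝-injective g g′ eqg)
  payload-injective (Min f) (Min f′) refl eq = cong Min (⌜⌝-injective f f′ eq)

  payloads-injective : (gs hs : Vec (Code n) m) → payloads gs ≡ payloads hs → gs ≡ hs
  payloads-injective []       []       _  = refl
  payloads-injective (g ∷ gs) (h ∷ hs) eq
    with eq₁ , eq₂ ← pair-injective ⌜ g ⌝ (payloads gs) ⌜ h ⌝ (payloads hs) eq
    = cong₂ _∷_ (⌜⌝-injective g h eq₁) (payloads-injective gs hs eq₂)

-- Evaluation of codes

mutual
  ⇓-deterministic : ∀ {c : Code n} {xs y z} → c [ xs ]⇓ y → c [ xs ]⇓ z → y ≡ z
  ⇓-deterministic ⇓Zero ⇓Zero = refl
  ⇓-deterministic ⇓Succ ⇓Succ = refl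
  ⇓-deterministic ⇓Proj ⇓Proj = refl
  ⇓-deterministic (⇓Comp ps p) (⇓Comp qs q)
    with refl ← ⇓-deterministic* ps qs = ⇓-deterministic p q
  ⇓-deterministic (⇓Rec₀ p) (⇓Rec₀ q) = ⇓-deterministic p q
  ⇓-deterministic (⇓Recₛ p p′) (⇓Recₛ q q′)
    with refl ← ⇓-deterministic p q = ⇓-deterministic p′ q′
  ⇓-deterministic (⇓Min {k = k} p ps) (⇓Min {k = l} q qs) with <-cmp k l
  ... | tri≈ _ k≡l _ = k≡l
  ... | tri< k<l _ _ with _ , q′ ← qs k k<l = ⊥-elim (0≢1+n (⇓-deterministic p q′))
  ... | tri> _ _ l<k with _ , p′ ← ps l l<k = ⊥-elim (0≢1+n (sym (⇓-deterministic p′ q)))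

  ⇓-deterministic* : ∀ {gs : Vec (Code n) m} {xs ys zs} →
    Pointwise (λ g z → g [ xs ]⇓ z) gs ys →
    Pointwise (λ g z → g [ xs ]⇓ z) gs zs → ys ≡ zs
  ⇓-deterministic* []       []       = refl
  ⇓-deterministic* (p ∷ ps) (q ∷ qs) =
    cong₂ _∷_ (⇓-deterministic p q) (⇓-deterministic* ps qs)

-- The set of values of a code of a unary function.
Range : Code 1 → Pred ℕ 0ℓ
Range e k = ∃[ i ] e [ i ∷ [] ]⇓ k

Range⇔ : ∀ {h : Vec ℕ 1 → ℕ} {e} → (∀ xs → e [ xs ]⇓ h xs) →
  ∀ k → Range e k ⇔ (∃[ i ] h (i ∷ []) ≡ k)
Range⇔ e⇓h k = mk⇔
  (λ (i , e⇓k) → i , ⇓-deterministic (e⇓h (i ∷ [])) e⇓k)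
  (λ { (i , refl) → i , e⇓h (i ∷ []) })

const : ℕ → Code 0
const zero    = Zero
const (suc k) = Comp Succ (const k ∷ [])

const⇓ : ∀ k → const k [ [] ]⇓ k
const⇓ zero    = ⇓Zero
const⇓ (suc k) = ⇓Comp (const⇓ k ∷ []) ⇓Succ

-- Sets that are recursively enumerable

RESet-resp : {A : Pred ℕ a} {B : Pred ℕ b} → (∀ k → A k ⇔ B k) → RESet A → RESet B
RESet-resp A⇔B (inj₁ empty)         = inj₁ (λ k → empty k ∘ from (A⇔B k))
RESet-resp A⇔B (inj₂ (h , rec , p)) =
  inj₂ (h , rec , λ k → mk⇔ (to (p k) ∘ from (A⇔B k)) (to (A⇔B k) ∘ from (p k)))

-- The entries of the sequence x, xs in order, the last one repeated forever.
nth : ℕ → List ℕ → ℕ → ℕ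
nth x []       _       = x
nth x (y ∷ ys) zero    = x
nth x (y ∷ ys) (suc i) = nth y ys i

nth-code : ℕ → List ℕ → Code 1
nth-code x []       = Comp (const x) []
nth-code x (y ∷ ys) = Rec (const x) (Comp (nth-code y ys) (Proj zero ∷ []))

nth-code⇓ : ∀ x xs i → nth-code x xs [ i ∷ [] ]⇓ nth x xs i
nth-code⇓ x []       i       = ⇓Comp [] (const⇓ x)
nth-code⇓ x (y ∷ ys) zero    = ⇓Rec₀ (const⇓ x)
nth-code⇓ x (y ∷ ys) (suc i) =
  ⇓Recₛ (nth-code⇓ x (y ∷ ys) i) (⇓Comp (⇓Proj ∷ []) (nth-code⇓ y ys i))

∈⇒nth : ∀ {k} x xs → k Membership.∈ (x ∷ xs) → ∃[ i ] nth x xs i ≡ k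
∈⇒nth x []       (here refl) = 0 , refl
∈⇒nth x (y ∷ ys) (here refl) = 0 , refl
∈⇒nth x (y ∷ ys) (there k∈) with i , eq ← ∈⇒nth y ys k∈ = suc i , eq

nth∈ : ∀ x xs i → nth x xs i Membership.∈ (x ∷ xs)
nth∈ x []       _       = here refl
nth∈ x (y ∷ ys) zero    = here refl
nth∈ x (y ∷ ys) (suc i) = there (nth∈ y ys i)

list-RESet : (xs : List ℕ) → RESet (λ k → k Membership.∈ xs)
list-RESet []       = inj₁ (λ _ ())
list-RESet (x ∷ xs) =
  inj₂ ( (λ { (i ∷ []) → nth x xs i })
       , (nth-code x xs , λ { (i ∷ []) → nth-code⇓ x xs i })
       , λ k → mk⇔ (∈⇒nth x xs) (λ { (i , refl) → nth∈ x xs i }) )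

-- A nonempty recursive set is the range of a recursive function: send its
-- elements to themselves and all other numbers to a fixed element of the set.
recursive⇒range : {A : Pred ℕ a} → RecursiveSet A → ∃ A →
  ∃[ h ] Recursive {1} h × (∀ k → A k ⇔ (∃[ i ] h (i ∷ []) ≡ k))
recursive⇒range {A = A} (χ , (e , e⇓χ) , χ-spec) (x₀ , x₀∈A) =
  h , (Comp select (e ∷ Proj zero ∷ []) , h⇓) ,
  λ k → mk⇔ (λ k∈A → k , h-fixes k k∈A) (λ { (i , refl) → h∈A i })
  where
  choose : ℕ → ℕ → ℕ
  choose zero    k = x₀
  choose (suc _) k = k

  select : Code 2
  select = Rec (Comp (const x₀) []) (Proj (suc (suc zero)))

  select⇓ : ∀ t k → select [ t ∷ k ∷ [] ]⇓ choose t k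
  select⇓ zero    k = ⇓Rec₀ (⇓Comp [] (const⇓ x₀))
  select⇓ (suc t) k = ⇓Recₛ (select⇓ t k) ⇓Proj

  h : Vec ℕ 1 → ℕ
  h (k ∷ []) = choose (χ (k ∷ [])) k

  h⇓ : ∀ xs → Comp select (e ∷ Proj zero ∷ []) [ xs ]⇓ h xs
  h⇓ (k ∷ []) = ⇓Comp (e⇓χ _ ∷ ⇓Proj ∷ []) (select⇓ _ k)

  h∈A : ∀ k → A (h (k ∷ []))
  h∈A k with χ-spec k
  ... | inj₁ (k∈A , χ≡1) rewrite χ≡1 = k∈A
  ... | inj₂ (_   , χ≡0) rewrite χ≡0 = x₀∈A

  h-fixes : ∀ k → A k → h (k ∷ []) ≡ k
  h-fixes k k∈A with χ-spec k
  ... | inj₁ (_   , χ≡1) rewrite χ≡1 = refl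
  ... | inj₂ (k∉A , _)   = ⊥-elim (k∉A k∈A)

-- Meeting countably many requirements

Unbounded : Pred ℕ a → Set a
Unbounded A = ∀ b → ∃[ k ] b ≤ k × A k

Bounded : Pred ℕ a → Set a
Bounded A = ∃[ b ] (∀ k → A k → k < b)

-- Consequences of excluded middle for sets of natural numbers.
module Classical (em : ExcludedMiddle 0ℓ) where

  unbounded-or-bounded : (A : Pred ℕ 0ℓ) → Unbounded A ⊎ Bounded A
  unbounded-or-bounded A with em {Bounded A}
  ... | yes bounded = inj₂ bounded
  ... | no ¬bounded = inj₁ beyond
    where
    beyond : Unbounded A
    beyond b with em {∃[ k ] b ≤ k × A k}
    ... | yes p = p
    ... | no ¬p = ⊥-elim (¬bounded (b , λ k k∈A → ≰⇒> (λ b≤k → ¬p (k , b≤k , k∈A))))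

  -- The image of a bounded set under any function is r.e., being finite.
  bounded-image-RESet : (A : Pred ℕ 0ℓ) (G : ℕ → ℕ) → Bounded A →
    RESet (λ k → ∃[ i ] A i × G i ≡ k)
  bounded-image-RESet A G (b , below) = RESet-resp members (list-RESet values)
    where
    A? : ∀ k → Dec (A k)
    A? k = em

    values : List ℕ
    values = map G (filter A? (upTo b))

    members : ∀ k → k Membership.∈ values ⇔ (∃[ i ] A i × G i ≡ k)
    members k = mk⇔
      (λ k∈ → let i , i∈ , k≡Gi = ∈-map⁻ G {xs = filter A? (upTo b)} k∈
              in i , proj₂ (∈-filter⁻ A? {xs = upTo b} i∈) , sym k≡Gi)
      (λ { (i , i∈A , refl) → ∈-map⁺ G (∈-filter⁺ A? (∈-upTo⁺ (below i i∈A)) i∈A) })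

  -- A requirement i asks F to agree with v i at some point of A i.  Here I is
  -- countable by way of an injective numbering of it.
  module Requirements {I : Set} (number : I → ℕ)
    (number-injective : ∀ i i′ → number i ≡ number i′ → i ≡ i′)
    (A : I → Pred ℕ 0ℓ) where

    -- Some requirement has number s and can be met at some k ≥ b.
    Candidate : ℕ → ℕ → Set
    Candidate s b = ∃[ i ] number i ≡ s × ∃[ k ] b ≤ k × A i k

    -- The choice made at stage s, when b exceeds all points already used.
    pick : ∀ s b → ∃[ k ] b ≤ k × (∀ i → number i ≡ s → Unbounded (A i) → A i k)
    pick s b with em {Candidate s b}
    ... | yes (i , refl , k , b≤k , k∈A) =
      k , b≤k , λ i′ eq _ → subst (λ i″ → A i″ k) (sym (number-injective i′ i eq)) k∈A
    ... | no ¬candidate =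
      b , ≤-refl , λ i eq unbounded → ⊥-elim (¬candidate (i , eq , unbounded b))

    -- The number bound s exceeds the points chosen before stage s, and point s
    -- is the one chosen at stage s.
    bound : ℕ → ℕ
    bound zero    = 0
    bound (suc s) = suc (proj₁ (pick s (bound s)))

    point : ℕ → ℕ
    point s = proj₁ (pick s (bound s))

    point<bound : ∀ s t → suc s ≤′ t → point s < bound t
    point<bound s _ ≤′-refl           = ≤-refl
    point<bound s _ (≤′-step {t} s<t) =
      m<n⇒m<1+n (<-≤-trans (point<bound s t s<t) (proj₁ (proj₂ (pick t (bound t)))))

    point-increasing : ∀ s t → s < t → point s < point t
    point-increasing s t s<t =
      <-≤-trans (point<bound s t (≤⇒≤′ s<t)) (proj₁ (proj₂ (pick t (bound t))))

    point-injective : ∀ s t → point s ≡ point t → s ≡ t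
    point-injective s t eq with <-cmp s t
    ... | tri< s<t _ _ = ⊥-elim (<⇒≢ (point-increasing s t s<t) eq)
    ... | tri≈ _ s≡t _ = s≡t
    ... | tri> _ _ t<s = ⊥-elim (<⇒≢ (point-increasing t s t<s) (sym eq))

    -- Distinct requirements have distinct points, so they cannot conflict.
    satisfy-all : {B : Set b} → B → (v : I → ℕ → B) →
      Σ[ F ∈ (ℕ → B) ] (∀ i → Unbounded (A i) → ∃[ k ] A i k × F k ≡ v i k)
    satisfy-all {B = B} default v = F , meets
      where
      F : ℕ → B
      F k with em {∃[ i ] point (number i) ≡ k}
      ... | yes (i , _) = v i k
      ... | no _        = default

      F-at-point : ∀ i → F (point (number i)) ≡ v i (point (number i))
      -- The requirement found when F is evaluated here is i itself, because both
      -- the points and the numbering are injective.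
      F-at-point i with em {∃[ i′ ] point (number i′) ≡ point (number i)}
      ... | yes (i′ , eq) =
        cong (λ i″ → v i″ _) (number-injective i′ i (point-injective _ _ eq))
      ... | no ¬p = ⊥-elim (¬p (i , refl))

      meets : ∀ i → Unbounded (A i) → ∃[ k ] A i k × F k ≡ v i k
      meets i unbounded =
        point (number i) ,
        proj₂ (proj₂ (pick (number i) (bound (number i)))) i refl unbounded ,
        F-at-point i

-- Recursive rings as sets of natural numbers

module Representation {c ℓ} (R : RecursiveRing c ℓ) where
  open RecursiveRing R public
  open Ring ring public using (0#)
    renaming (refl to ≈-refl; sym to ≈-sym; trans to ≈-trans; reflexive to ≈-reflexive)

  j-injective : ∀ {x y} → j x ≡ j y → x ≈ y
  j-injective = Injection.injective representation

  j-cong : ∀ {x y} → x ≈ y → j x ≡ j y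
  j-cong = Injection.cong representation

  -- A left inverse of j; numbers outside the image go to 0#.
  decode : ℕ → Carrier
  decode k with proj₂ (proj₂ image-recursive) k
  ... | inj₁ ((x , _) , _) = x
  ... | inj₂ _             = 0#

  decode-j : ∀ x → decode (j x) ≈ x
  decode-j x with proj₂ (proj₂ image-recursive) (j x)
  ... | inj₁ ((_ , eq) , _)  = j-injective eq
  ... | inj₂ (jx∉image , _)  = ⊥-elim (jx∉image (x , refl))

  image-range : ∃[ h ] Recursive {1} h ×
    (∀ k → (∃[ x ] j x ≡ k) ⇔ (∃[ i ] h (i ∷ []) ≡ k))
  image-range = recursive⇒range image-recursive (j 0# , 0# , refl)

  -- A code whose range is the image of R under j.
  image-code : Code 1
  image-code = proj₁ (proj₁ (proj₂ image-range))

  Range-image-code⇔ : ∀ k → Range image-code k ⇔ (∃[ x ] j x ≡ k)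
  Range-image-code⇔ k = mk⇔ (from (spec k) ∘ to range) (from range ∘ to (spec k))
    where
    spec = proj₂ (proj₂ image-range)

    range : Range image-code k ⇔ (∃[ i ] proj₁ image-range (i ∷ []) ≡ k)
    range = Range⇔ (proj₂ (proj₁ (proj₂ image-range))) k

  module _ (em : ExcludedMiddle 0ℓ) (infinite : Infinite R) where

    image-unbounded : Unbounded (Range image-code)
    image-unbounded with Classical.unbounded-or-bounded em (Range image-code)
    ... | inj₁ unbounded   = unbounded
    ... | inj₂ (b , below) = ⊥-elim (infinite (map decode (upTo b) , λ x →
      map⁺ (Any.map
        (λ { refl → ≈-sym (decode-j x) })
        (∈-upTo⁺ (below (j x) (from (Range-image-code⇔ (j x)) (x , refl)))))))

    another : ∀ x → ∃[ y ] ¬ (j x ≡ j y)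
    another x with k , jx<k , k∈ ← image-unbounded (suc (j x))
              with y , refl ← to (Range-image-code⇔ k) k∈ = y , <⇒≢ jx<k

-- A surjective r.e. preserving map that is not recursive

-- Two kinds of requirement on a function F from ℕ to R₂: takes e n asks that F
-- take the value decode n on the range of e, and differs e asks that e not
-- compute the representation of F throughout the image of R₁.
data Requirement : Set where
  takes   : Code 1 → ℕ → Requirement
  differs : Code 1 → Requirement

-- The first component of the pair tells the two kinds apart.
number : Requirement → ℕ
number (takes e n) = pair (suc n) ⌜ e ⌝
number (differs e) = pair 0 ⌜ e ⌝

number-injective : ∀ r r′ → number r ≡ number r′ → r ≡ r′
number-injective (takes e n) (takes e′ n′) eq
  with refl , eq′ ← pair-injective (suc n) ⌜ e ⌝ (suc n′) ⌜ e′ ⌝ eq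
  = cong (λ c → takes c n) (⌜⌝-injective e e′ eq′)
number-injective (takes e n) (differs e′) eq
  with () , _ ← pair-injective (suc n) ⌜ e ⌝ 0 ⌜ e′ ⌝ eq
number-injective (differs e) (takes e′ n) eq
  with () , _ ← pair-injective 0 ⌜ e ⌝ (suc n) ⌜ e′ ⌝ eq
number-injective (differs e) (differs e′) eq =
  cong differs (⌜⌝-injective e e′ (proj₂ (pair-injective 0 ⌜ e ⌝ 0 ⌜ e′ ⌝ eq)))

-- The function F and the map f = F ∘ j₁ that it induces from R₁ to R₂.
module Construction (em : ExcludedMiddle 0ℓ) {c₁ ℓ₁ c₂ ℓ₂ : Level}
  (R₁ : RecursiveRing c₁ ℓ₁) (R₂ : RecursiveRing c₂ ℓ₂)
  (infinite₁ : Infinite R₁) (infinite₂ : Infinite R₂) where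

  private
    module R₁ = Representation R₁
    module R₂ = Representation R₂

  open Classical em

  -- An element of R₂ not represented by the value of e at k.
  avoid : (e : Code 1) (k : ℕ) → ∃[ y ] ¬ (e [ k ∷ [] ]⇓ R₂.j y)
  avoid e k with em {e [ k ∷ [] ]⇓ R₂.j R₂.0#}
  ... | no ¬p = R₂.0# , ¬p
  ... | yes p with y , j0≢jy ← R₂.another em infinite₂ R₂.0# =
    y , λ q → j0≢jy (⇓-deterministic p q)

  -- The points at which a requirement may be met, and the value that meets it.
  domain : Requirement → Pred ℕ 0ℓ
  domain (takes e _) = Range e
  domain (differs _) = Range R₁.image-code

  value : Requirement → ℕ → R₂.Carrier
  value (takes _ n) _ = R₂.decode n
  value (differs e) k = proj₁ (avoid e k)

  -- Opaque: only the property of F matters below, not how F is chosen.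
  abstract
    solution : Σ[ F ∈ (ℕ → R₂.Carrier) ]
      (∀ r → Unbounded (domain r) → ∃[ k ] domain r k × F k ≡ value r k)
    solution = Requirements.satisfy-all number number-injective domain R₂.0# value

  F : ℕ → R₂.Carrier
  F = proj₁ solution

  f : R₁.Carrier → R₂.Carrier
  f x = F (R₁.j x)

  f-cong : ∀ {x x′} → x R₁.≈ x′ → f x R₂.≈ f x′
  f-cong x≈x′ = R₂.≈-reflexive (cong F (R₁.j-cong x≈x′))

  -- F maps every unbounded r.e. set onto R₂.
  F-onto : ∀ e → Unbounded (Range e) → ∀ y → ∃[ k ] Range e k × F k R₂.≈ y
  F-onto e unbounded y with k , k∈ , eq ← proj₂ solution (takes e (R₂.j y)) unbounded =
    k , k∈ , R₂.≈-trans (R₂.≈-reflexive eq) (R₂.decode-j y)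

  f-onto : ∀ y → ∃[ x ] f x R₂.≈ y
  f-onto y with k , k∈ , Fk≈y ← F-onto R₁.image-code (R₁.image-unbounded em infinite₁) y
           with x , refl ← to (R₁.Range-image-code⇔ k) k∈ = x , Fk≈y

  surjection : Surjection R₁.ringSetoid R₂.ringSetoid
  surjection = record
    { to         = f
    ; cong       = f-cong
    ; surjective = λ y → let x , fx≈y = f-onto y
                         in x , λ z≈x → R₂.≈-trans (f-cong z≈x) fx≈y
    }

  f-preserves-RE : REPreserving R₁ R₂ f
  f-preserves-RE S (inj₁ empty) =
    inj₁ (λ { _ (_ , (x , x∈S , _) , _) → empty (R₁.j x) (x , x∈S , refl) })
  -- Here the range of e is the image of S in ℕ.
  f-preserves-RE S (inj₂ (h , (e , e⇓h) , spec)) with unbounded-or-bounded (Range e)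
  ... | inj₁ unbounded = RESet-resp onto (inj₂ R₂.image-range)
    where
    onto : ∀ k → (∃[ y ] R₂.j y ≡ k) ⇔ (∃[ y ] image R₁ R₂ f S y × R₂.j y ≡ k)
    onto k = mk⇔ everything (λ (y , _ , eq) → y , eq)
      where
      everything : (∃[ y ] R₂.j y ≡ k) → ∃[ y ] image R₁ R₂ f S y × R₂.j y ≡ k
      everything (y , jy≡k)
        with i , i∈ , Fi≈y ← F-onto e unbounded y
        with x , x∈S , refl ← from (spec i) (to (Range⇔ e⇓h i) i∈)
        = y , (x , x∈S , Fi≈y) , jy≡k
  ... | inj₂ bounded =
    RESet-resp finite (bounded-image-RESet (Range e) (R₂.j ∘ F) bounded)
    where
    finite : ∀ k → (∃[ i ] Range e i × R₂.j (F i) ≡ k) ⇔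
                   (∃[ y ] image R₁ R₂ f S y × R₂.j y ≡ k)
    finite k = mk⇔ forth back
      where
      forth : ∃[ i ] Range e i × R₂.j (F i) ≡ k → ∃[ y ] image R₁ R₂ f S y × R₂.j y ≡ k
      forth (i , i∈ , eq)
        with x , x∈S , refl ← from (spec i) (to (Range⇔ e⇓h i) i∈)
        = f x , (x , x∈S , R₂.≈-refl) , eq

      back : ∃[ y ] image R₁ R₂ f S y × R₂.j y ≡ k → ∃[ i ] Range e i × R₂.j (F i) ≡ k
      back (y , (x , x∈S , fx≈y) , eq) =
        R₁.j x ,
        from (Range⇔ e⇓h _) (to (spec _) (x , x∈S , refl)) ,
        trans (R₂.j-cong fx≈y) eq

  f-not-recursive : ¬ RecursiveMap R₁ R₂ f
  f-not-recursive (g , (e , e⇓g) , g-spec)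
    with k , k∈ , Fk≡ ← proj₂ solution (differs e) (R₁.image-unbounded em infinite₁)
    with x , refl ← to (R₁.Range-image-code⇔ k) k∈
    = proj₂ (avoid e (R₁.j x))
        (subst (e [ R₁.j x ∷ [] ]⇓_) (trans (g-spec x) (cong R₂.j Fk≡)) (e⇓g _))

lemma6p10 : ExcludedMiddle 0ℓ →
    ∀ {c₁ ℓ₁ c₂ ℓ₂} (R₁ : RecursiveRing c₁ ℓ₁) (R₂ : RecursiveRing c₂ ℓ₂) →
    Infinite R₁ → Infinite R₂ →
    Σ[ f ∈ Surjection (RecursiveRing.ringSetoid R₁) (RecursiveRing.ringSetoid R₂) ]
    REPreserving R₁ R₂ (Surjection.to f) ×
    ¬ RecursiveMap R₁ R₂ (Surjection.to f)
lemma6p10 em R₁ R₂ infinite₁ infinite₂ = surjection , f-preserves-RE , f-not-recursive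
  where open Construction em R₁ R₂ infinite₁ infinite₂
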